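{- For every formula $\varphi\in\mathcal{L}$: $\vdash_{\mathsf{IM}\oplus\mathsf{K}}\varphi$ if and only if the sequent $\varphi^\circ$ is derivable in the calculus $\mathcal{C}_{\mathsf{IM}\oplus\mathsf{K}}$.
   Context: Language: $\mathcal{L}$ is generated by $\varphi ::= p \mid \bot \mid \varphi\wedge\varphi \mid \varphi\vee\varphi \mid \varphi\to\varphi \mid \Box\varphi \mid \Diamond\varphi$; $\neg\varphi := \varphi\to\bot$, $\top := \neg\bot$. Logics: $\mathsf{IM}$ is obtained by extending an axiomatisation of intuitionistic propositional logic over $\mathcal{L}$ with the rules "from $\varphi\to\psi$ infer $\Box\varphi\to\Box\psi$" and "from $\varphi\to\psi$ infer $\Diamond\varphi\to\Diamond\psi$" and the axioms $(\Box\varphi\wedge\Diamond\neg\varphi)\to\bot$ and $(\Box\top\to\Diamond\varphi)\to\Diamond\varphi$, closed under modus ponens and uniform substitution. $\mathsf{IM}\oplus\mathsf{K}$ additionally has (with the same closure) the axiom $\mathsf{K}$, the conjunction of $\Box(\varphi\to\psi)\to(\Box\varphi\to\Box\psi)$ and $\Box(\varphi\to\psi)\to(\Diamond\varphi\to\Diamond\psi)$. Sequents: a marked formula is an input formula $\varphi^\bullet$ or an output formula $\varphi^\circ$ with $\varphi\in\mathcal{L}$. A block is $\{\Delta\}$ with $\Delta$ a finite multiset of marked formulas; an input block contains only input formulas (or is empty), an output block contains exactly one output formula, possibly together with input formulas. A sequent has the form $\Gamma=\Lambda,\Pi$ where $\Lambda$ is a finite multiset of input formulas and input blocks and $\Pi$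 is empty, or one output formula, or one output block. Below $\Gamma$ ranges over sequents, $\Lambda$ over sequents with only input components, $\Delta,\Sigma$ (when placed inside blocks) over finite multisets of marked formulas, and all rule instances must consist of sequents. The output pruning $\Gamma^\downarrow$ deletes the output formula if it does not occur inside a block, and replaces the output block (if there is one) by the empty block $\{\ \}$. Rules of $\mathcal{C}_{\mathsf{IM}\oplus\mathsf{K}}$ (premisses / conclusion): $\bot^\bullet$: (no premiss) / $\Gamma,\bot^\bullet$. $\mathsf{id}$: (no premiss) / $\Lambda,p^\bullet,p^\circ$ ($p$ a proposition letter). $\wedge^\bullet$: $\Gamma,\varphi^\bullet,\psi^\bullet$ / $\Gamma,(\varphi\wedge\psi)^\bullet$. $\wedge^\circ$: $\Lambda,\varphi^\circ$ and $\Lambda,\psi^\circ$ / $\Lambda,(\varphi\wedge\psi)^\circ$. $\vee^\bullet$: $\Gamma,\varphi^\bullet$ and $\Gamma,\psi^\bullet$ / $\Gamma,(\varphi\vee\psi)^\bullet$. $\vee^\circ$: $\Lambda,\varphi^\circ$ / $\Lambda,(\varphi\vee\psi)^\circ$; and $\Lambda,\psi^\circ$ / $\Lambda,(\varphi\vee\psi)^\circ$. $\to^\bullet$: $\Gamma^\downarrow,(\varphi\to\psi)^\bullet,\varphi^\circ$ and $\Gamma,\psi^\bullet$ / $\Gamma,(\varphi\to\psi)^\bullet$. $\to^\circ$: $\Lambda,\varphi^\bullet,\psi^\circ$ / $\Lambda,(\varphi\to\psi)^\circ$. $\Box^\bullet$: $\Gamma,\{\varphi^\bullet\}$ / $\Gamma,(\Box\varphi)^\bullet$.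 $\Box^\circ$: $\Delta,\varphi^\circ$ / $\Lambda,\{\Delta\},(\Box\varphi)^\circ$. $\Diamond^\bullet$: $\varphi^\bullet,\Delta$ / $\Gamma,(\Diamond\varphi)^\bullet,\{\Delta\}$. $\Diamond^\circ$: $\Lambda,\{\varphi^\circ\}$ / $\Lambda,(\Diamond\varphi)^\circ$. $\mathsf{k}$: $\Gamma,\{\Delta,\Sigma\}$ / $\Gamma,\{\Delta\},\{\Sigma\}$. -}

module Defs where

open import Data.Nat.Base using (ℕ)
open import Data.List.Base using (List; []; _∷_; _++_; [_]; map)
open import Data.List.Relation.Binary.Permutation.Propositional using (_↭_)
open import Data.List.Relation.Binary.Permutation.Homogeneous using (Permutation)

infix  30 □_ ◇_ ¬_
infixr 25 _∧_
infixr 24 _∨_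
infixr 23 _⇒_

data Formula : Set where
  var : ℕ → Formula
  ⊥   : Formula
  _∧_ _∨_ _⇒_ : Formula → Formula → Formula
  □_ ◇_ : Formula → Formula

¬_ : Formula → Formula
¬ φ = φ ⇒ ⊥

⊤ : Formula
⊤ = ¬ ⊥

Substitution : Set
Substitution = ℕ → Formula

_⟨_⟩ : Formula → Substitution → Formula
var p   ⟨ σ ⟩ = σ p
⊥       ⟨ σ ⟩ = ⊥
(φ ∧ ψ) ⟨ σ ⟩ = (φ ⟨ σ ⟩) ∧ (ψ ⟨ σ ⟩)
(φ ∨ ψ) ⟨ σ ⟩ = (φ ⟨ σ ⟩) ∨ (ψ ⟨ σ ⟩)
(φ ⇒ ψ) ⟨ σ ⟩ = (φ ⟨ σ ⟩) ⇒ (ψ ⟨ σ ⟩)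
(□ φ)   ⟨ σ ⟩ = □ (φ ⟨ σ ⟩)
(◇ φ)   ⟨ σ ⟩ = ◇ (φ ⟨ σ ⟩)

data IPCAxiom : Formula → Set where
  ⇒-const : ∀ φ ψ → IPCAxiom (φ ⇒ ψ ⇒ φ)
  ⇒-dist  : ∀ φ ψ χ → IPCAxiom ((φ ⇒ ψ ⇒ χ) ⇒ (φ ⇒ ψ) ⇒ φ ⇒ χ)
  ∧-intro : ∀ φ ψ → IPCAxiom (φ ⇒ ψ ⇒ φ ∧ ψ)
  ∧-elim₁ : ∀ φ ψ → IPCAxiom (φ ∧ ψ ⇒ φ)
  ∧-elim₂ : ∀ φ ψ → IPCAxiom (φ ∧ ψ ⇒ ψ)
  ∨-intro₁ : ∀ φ ψ → IPCAxiom (φ ⇒ φ ∨ ψ)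
  ∨-intro₂ : ∀ φ ψ → IPCAxiom (ψ ⇒ φ ∨ ψ)
  ∨-elim  : ∀ φ ψ χ → IPCAxiom ((φ ⇒ χ) ⇒ (ψ ⇒ χ) ⇒ φ ∨ ψ ⇒ χ)
  ⊥-elim  : ∀ φ → IPCAxiom (⊥ ⇒ φ)

infix 2 ⊢IM⊕K_

-- Theoremhood in IM ⊕ K.
data ⊢IM⊕K_ : Formula → Set where
  ipc     : ∀ {φ} → IPCAxiom φ → ⊢IM⊕K φ
  ax-□◇⊥  : ∀ φ → ⊢IM⊕K (□ φ ∧ ◇ (¬ φ)) ⇒ ⊥
  ax-□⊤◇  : ∀ φ → ⊢IM⊕K (□ ⊤ ⇒ ◇ φ) ⇒ ◇ φ
  ax-K    : ∀ φ ψ → ⊢IM⊕K (□ (φ ⇒ ψ) ⇒ (□ φ ⇒ □ ψ)) ∧ (□ (φ ⇒ ψ) ⇒ (◇ φ ⇒ ◇ ψ))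
  □-mono  : ∀ {φ ψ} → ⊢IM⊕K φ ⇒ ψ → ⊢IM⊕K □ φ ⇒ □ ψ
  ◇-mono  : ∀ {φ ψ} → ⊢IM⊕K φ ⇒ ψ → ⊢IM⊕K ◇ φ ⇒ ◇ ψ
  mp      : ∀ {φ ψ} → ⊢IM⊕K φ ⇒ ψ → ⊢IM⊕K φ → ⊢IM⊕K ψ
  us      : ∀ {φ} (σ : Substitution) → ⊢IM⊕K φ → ⊢IM⊕K φ ⟨ σ ⟩

-- Finite multisets are represented by lists; reordering, also inside blocks,
-- is the relation _≈_ below.

-- φ • is an input formula, and { Δ } (written ⟦ Δ ⟧) an input block. The
-- members of Δ are all inputs, so they carry no marker inside the block.
infix 22 _• _°

data Input : Set where
  _•  : Formula → Input
  ⟦_⟧ : List Formula → Input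

-- The component Π of a sequent Λ , Π: empty, an output formula φ °, or an
-- output block ⟦ Δ , φ °⟧ with input formulas Δ and the one output formula φ.
data Output : Set where
  ∅      : Output
  _°     : Formula → Output
  ⟦_,_°⟧ : List Formula → Formula → Output

infix 4 _▸_
infixr 3 _,_

record Sequent : Set where
  constructor _▸_
  field
    inputs : List Input
    output : Output

open Sequent public

_,_ : Input → Sequent → Sequent
x , (Λ ▸ Π) = x ∷ Λ ▸ Π

-- The output pruning. The result never has an output component, so it is given
-- by its list of inputs.
_↓ : Sequent → List Input
(Λ ▸ ∅)          ↓ = Λ
(Λ ▸ φ °)        ↓ = Λ
(Λ ▸ ⟦ Δ , φ °⟧) ↓ = ⟦ [] ⟧ ∷ Λ

infix 4 _≈ᵢ_ _≈ₒ_ _≈_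

data _≈ᵢ_ : Input → Input → Set where
  fm  : ∀ {φ} → φ • ≈ᵢ φ •
  blk : ∀ {Δ Δ′} → Δ ↭ Δ′ → ⟦ Δ ⟧ ≈ᵢ ⟦ Δ′ ⟧

data _≈ₒ_ : Output → Output → Set where
  empty : ∅ ≈ₒ ∅
  fm    : ∀ {φ} → φ ° ≈ₒ φ °
  blk   : ∀ {Δ Δ′ φ} → Δ ↭ Δ′ → ⟦ Δ , φ °⟧ ≈ₒ ⟦ Δ′ , φ °⟧

record _≈_ (Γ Γ′ : Sequent) : Set where
  constructor _▸_
  field
    inputs-≈ : Permutation _≈ᵢ_ (inputs Γ) (inputs Γ′)
    output-≈ : output Γ ≈ₒ output Γ′

infix 2 C⊢_

-- Derivability in the nested sequent calculus. In ◇• and k, a block { Δ } in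
-- the conclusion may be an input or an output block; since only one output may
-- occur in a sequent, each of these rules splits into two constructors, where
-- the ones marked ᵢ concern input blocks only and the ones marked ₒ concern an
-- output block. In k, at most one of the two blocks is an output block, and
-- exch allows us to write it last. In □° the block is necessarily an input
-- block because □ φ is already an output.
data C⊢_ : Sequent → Set where
  exch : ∀ {Γ Γ′} → Γ ≈ Γ′ → C⊢ Γ → C⊢ Γ′

  ⊥•  : ∀ {Γ} → C⊢ ⊥ • , Γ
  id  : ∀ {Λ p} → C⊢ var p • ∷ Λ ▸ var p °

  ∧•  : ∀ {Γ φ ψ} → C⊢ φ • , ψ • , Γ → C⊢ (φ ∧ ψ) • , Γ
  ∧°  : ∀ {Λ φ ψ} → C⊢ Λ ▸ φ ° → C⊢ Λ ▸ ψ ° → C⊢ Λ ▸ (φ ∧ ψ) °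

  ∨•  : ∀ {Γ φ ψ} → C⊢ φ • , Γ → C⊢ ψ • , Γ → C⊢ (φ ∨ ψ) • , Γ
  ∨°₁ : ∀ {Λ φ ψ} → C⊢ Λ ▸ φ ° → C⊢ Λ ▸ (φ ∨ ψ) °
  ∨°₂ : ∀ {Λ φ ψ} → C⊢ Λ ▸ ψ ° → C⊢ Λ ▸ (φ ∨ ψ) °

  ⇒•  : ∀ {Γ φ ψ} →
        C⊢ (φ ⇒ ψ) • ∷ Γ ↓ ▸ φ ° → C⊢ ψ • , Γ → C⊢ (φ ⇒ ψ) • , Γ
  ⇒°  : ∀ {Λ φ ψ} → C⊢ φ • ∷ Λ ▸ ψ ° → C⊢ Λ ▸ (φ ⇒ ψ) °

  □•  : ∀ {Γ φ} → C⊢ ⟦ [ φ ] ⟧ , Γ → C⊢ (□ φ) • , Γ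
  □°  : ∀ {Λ Δ φ} → C⊢ map _• Δ ▸ φ ° → C⊢ ⟦ Δ ⟧ ∷ Λ ▸ (□ φ) °

  ◇•ᵢ : ∀ {Γ Δ φ} →
        C⊢ φ • ∷ map _• Δ ▸ ∅ → C⊢ (◇ φ) • , ⟦ Δ ⟧ , Γ
  ◇•ₒ : ∀ {Λ Δ φ ψ} →
        C⊢ φ • ∷ map _• Δ ▸ ψ ° → C⊢ (◇ φ) • ∷ Λ ▸ ⟦ Δ , ψ °⟧
  ◇°  : ∀ {Λ φ} → C⊢ Λ ▸ ⟦ [] , φ °⟧ → C⊢ Λ ▸ (◇ φ) °

  kᵢ  : ∀ {Γ Δ Σ} → C⊢ ⟦ Δ ++ Σ ⟧ , Γ → C⊢ ⟦ Δ ⟧ , ⟦ Σ ⟧ , Γ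
  kₒ  : ∀ {Λ Δ Σ φ} → C⊢ Λ ▸ ⟦ Δ ++ Σ , φ °⟧ → C⊢ ⟦ Δ ⟧ ∷ Λ ▸ ⟦ Σ , φ °⟧

{-# OPTIONS --safe #-}

-- A calculus derivation is sound for the reading of an input block Δ as □⋀Δ and
-- of an output block Δ, φ° as □⋀Δ → ◇φ. Conversely, cut is avoided by a semantic
-- argument. Since k merges input blocks, it suffices to consider sequents with
-- at most one of them; these are the worlds of a Kripke model in which
-- disjunction, □ and ◇ are forced in continuation style, so that forcing is
-- closed under whatever cut-free derivations can conclude. Every theorem is
-- forced, the forced formulas are derivable (reify), and the formulas occurring
-- on the left of a sequent are forced there (reflect). The clause for ◇ quantifies
-- over the ways in which ◇• passes from an output to that of its premiss; this
-- validates K, and (□⊤ → ◇φ) → ◇φ because an empty input block can be absorbed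
-- by the output block.
module Submission where

open import Defs hiding (_,_)
open import Data.List.Base using ([])
open import Function.Bundles using (_⇔_)

open import Data.List.Base using (List; _∷_; _++_; [_]; map)
open import Data.List.Membership.Propositional using (_∈_)
open import Data.List.Membership.Propositional.Properties using (∈-∃++)
open import Data.List.Properties using (++-identityʳ)
open import Data.List.Relation.Binary.Permutation.Homogeneous using (Permutation)
open import Data.List.Relation.Binary.Permutation.Propositional as Perm
  using (_↭_; ↭-sym; ↭-trans; ↭-reflexive)
open import Data.List.Relation.Binary.Permutation.Propositional.Properties
  using (All-resp-↭; ∈-resp-↭; shift; ++-comm; ++⁺ʳ; map⁺)
open import Data.List.Relation.Binary.Pointwise.Base using (Pointwise; []; _∷_)
import Data.List.Relation.Binary.Pointwise.Properties as Pointwise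
open import Data.List.Relation.Binary.Subset.Propositional using (_⊆_)
open import Data.List.Relation.Unary.All as All using (All; []; _∷_)
open import Data.List.Relation.Unary.All.Properties using (++⁺)
open import Data.List.Relation.Unary.Any using (here; there)
open import Data.Maybe.Base using (Maybe; just; nothing; fromMaybe)
open import Data.Product.Base using (∃; _×_; _,_; proj₁; proj₂)
open import Data.Sum.Base using (_⊎_; inj₁; inj₂)
open import Function.Base using (_∘_)
open import Function.Bundles using (mk⇔)
open import Relation.Binary.PropositionalEquality using (_≡_; refl; cong; cong₂; subst; sym)

-- Soundness

infix 3 _⊢ʰ_

-- Local consequence: the modal rules and substitution act only inside `thm`, on closed theorems, so
-- the deduction theorem holds.
data _⊢ʰ_ (Θ : List Formula) : Formula → Set where
  thm : ∀ {φ} → ⊢IM⊕K φ → Θ ⊢ʰ φ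
  hyp : ∀ {φ} → φ ∈ Θ → Θ ⊢ʰ φ
  _·_ : ∀ {φ ψ} → Θ ⊢ʰ φ ⇒ ψ → Θ ⊢ʰ φ → Θ ⊢ʰ ψ

infixl 8 _·_

private
  variable
    φ ψ χ θ : Formula
    Φ Φ₀ Φ′ Δ Δ′ Θ : List Formula
    Π π : Output

ax : IPCAxiom φ → Θ ⊢ʰ φ
ax a = thm (ipc a)

weakenʰ : Θ ⊢ʰ ψ → φ ∷ Θ ⊢ʰ ψ
weakenʰ (thm t) = thm t
weakenʰ (hyp i) = hyp (there i)
weakenʰ (d · e) = weakenʰ d · weakenʰ e

⊢ʰ-refl : Θ ⊢ʰ φ ⇒ φ
⊢ʰ-refl {φ = φ} = ax (⇒-dist φ (φ ⇒ φ) φ) · ax (⇒-const _ _) · ax (⇒-const _ _)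

deduction : φ ∷ Θ ⊢ʰ ψ → Θ ⊢ʰ φ ⇒ ψ
deduction (thm t)            = ax (⇒-const _ _) · thm t
deduction (hyp (here refl))  = ⊢ʰ-refl
deduction (hyp (there i))    = ax (⇒-const _ _) · hyp i
deduction (d · e)            = ax (⇒-dist _ _ _) · deduction d · deduction e

closed⇒theorem : [] ⊢ʰ φ → ⊢IM⊕K φ
closed⇒theorem (thm t) = t
closed⇒theorem (d · e) = mp (closed⇒theorem d) (closed⇒theorem e)

hyp₀ : φ ∷ Θ ⊢ʰ φ
hyp₀ = hyp (here refl)

hyp₁ : φ ∷ ψ ∷ Θ ⊢ʰ ψ
hyp₁ = hyp (there (here refl))

□-monoʰ : [ φ ] ⊢ʰ ψ → Θ ⊢ʰ □ φ → Θ ⊢ʰ □ ψ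
□-monoʰ d e = thm (□-mono (closed⇒theorem (deduction d))) · e

K□ : Θ ⊢ʰ □ (φ ⇒ ψ) → Θ ⊢ʰ □ φ → Θ ⊢ʰ □ ψ
K□ d e = ax (∧-elim₁ _ _) · thm (ax-K _ _) · d · e

K◇ : Θ ⊢ʰ □ (φ ⇒ ψ) → Θ ⊢ʰ ◇ φ → Θ ⊢ʰ ◇ ψ
K◇ d e = ax (∧-elim₂ _ _) · thm (ax-K _ _) · d · e

-- The axiom at `⊤`: `□ φ` yields `□ ⊤` and `◇ ⊥` yields `◇ (¬ ⊤)`.
□◇⊥ʰ : Θ ⊢ʰ □ φ → Θ ⊢ʰ ◇ ⊥ → Θ ⊢ʰ ⊥
□◇⊥ʰ d e =
  thm (ax-□◇⊥ ⊤) ·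
  (ax (∧-intro _ _) · □-monoʰ ⊢ʰ-refl d · (thm (◇-mono (ipc (⊥-elim _))) · e))

-- Sequents read as formulas

⋀ : List Formula → Formula
⋀ []      = ⊤
⋀ (φ ∷ Δ) = φ ∧ ⋀ Δ

⋀-elim : ∀ Δ → Θ ⊢ʰ ⋀ Δ → All (Θ ⊢ʰ_) Δ
⋀-elim []      d = []
⋀-elim (φ ∷ Δ) d = ax (∧-elim₁ _ _) · d ∷ ⋀-elim Δ (ax (∧-elim₂ _ _) · d)

⋀-intro : All (Θ ⊢ʰ_) Δ → Θ ⊢ʰ ⋀ Δ
⋀-intro []       = ⊢ʰ-refl
⋀-intro (d ∷ ds) = ax (∧-intro _ _) · d · ⋀-intro ds

⋀-mono : (∀ {Θ} → All (Θ ⊢ʰ_) Δ → All (Θ ⊢ʰ_) Δ′) → [ ⋀ Δ ] ⊢ʰ ⋀ Δ′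
⋀-mono {Δ = Δ} f = ⋀-intro (f (⋀-elim Δ hyp₀))

□⋀-++ : ∀ Δ Σ → Θ ⊢ʰ □ (⋀ Δ) → Θ ⊢ʰ □ (⋀ Σ) → Θ ⊢ʰ □ (⋀ (Δ ++ Σ))
□⋀-++ Δ Σ d e =
  K□ (□-monoʰ (deduction (⋀-intro (++⁺ (⋀-elim Δ hyp₁) (⋀-elim Σ hyp₀)))) d) e

⟪_⟫ᵢ : Input → Formula
⟪ φ •   ⟫ᵢ = φ
⟪ ⟦ Δ ⟧ ⟫ᵢ = □ (⋀ Δ)

⟪_⟫ₒ : Output → Formula
⟪ ∅           ⟫ₒ = ⊥
⟪ φ °         ⟫ₒ = φ
⟪ ⟦ Δ , φ °⟧ ⟫ₒ = □ (⋀ Δ) ⇒ ◇ φ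

infix 3 _⊢ʰ*_

_⊢ʰ*_ : List Formula → List Input → Set
Θ ⊢ʰ* Λ = All (λ x → Θ ⊢ʰ ⟪ x ⟫ᵢ) Λ

map•⁺ : All (Θ ⊢ʰ_) Δ → Θ ⊢ʰ* map _• Δ
map•⁺ []       = []
map•⁺ (d ∷ ds) = d ∷ map•⁺ ds

⊢ʰ-≈ᵢ : ∀ {x y} → x ≈ᵢ y → Θ ⊢ʰ ⟪ x ⟫ᵢ → Θ ⊢ʰ ⟪ y ⟫ᵢ
⊢ʰ-≈ᵢ fm      d = d
⊢ʰ-≈ᵢ (blk p) d = □-monoʰ (⋀-mono (All-resp-↭ p)) d

⊢ʰ-≈ₒ : π ≈ₒ Π → Θ ⊢ʰ ⟪ π ⟫ₒ → Θ ⊢ʰ ⟪ Π ⟫ₒ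
⊢ʰ-≈ₒ empty   d = d
⊢ʰ-≈ₒ fm      d = d
⊢ʰ-≈ₒ (blk p) d =
  deduction (weakenʰ d · □-monoʰ (⋀-mono (All-resp-↭ (↭-sym p))) hyp₀)

⊢ʰ*-Pointwise : ∀ {Λ Λ′} → Pointwise _≈ᵢ_ Λ Λ′ → Θ ⊢ʰ* Λ′ → Θ ⊢ʰ* Λ
⊢ʰ*-↭ : ∀ {Λ Λ′} → Permutation _≈ᵢ_ Λ Λ′ → Θ ⊢ʰ* Λ′ → Θ ⊢ʰ* Λ

≈ᵢ-sym : ∀ {x y} → x ≈ᵢ y → y ≈ᵢ x
≈ᵢ-sym fm      = fm
≈ᵢ-sym (blk p) = blk (↭-sym p)

⊢ʰ*-Pointwise []       []       = []
⊢ʰ*-Pointwise (e ∷ es) (d ∷ ds) = ⊢ʰ-≈ᵢ (≈ᵢ-sym e) d ∷ ⊢ʰ*-Pointwise es ds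

⊢ʰ*-↭ (Permutation.refl es)      ds           = ⊢ʰ*-Pointwise es ds
⊢ʰ*-↭ (Permutation.prep e p)     (d ∷ ds)     = ⊢ʰ-≈ᵢ (≈ᵢ-sym e) d ∷ ⊢ʰ*-↭ p ds
⊢ʰ*-↭ (Permutation.swap e f p)   (c ∷ d ∷ ds) =
  ⊢ʰ-≈ᵢ (≈ᵢ-sym e) d ∷ ⊢ʰ-≈ᵢ (≈ᵢ-sym f) c ∷ ⊢ʰ*-↭ p ds
⊢ʰ*-↭ (Permutation.trans p q)    ds           = ⊢ʰ*-↭ p (⊢ʰ*-↭ q ds)

cases : Θ ⊢ʰ φ ∨ ψ → φ ∷ Θ ⊢ʰ χ → ψ ∷ Θ ⊢ʰ χ → Θ ⊢ʰ χ
cases d e f = ax (∨-elim _ _ _) · deduction e · deduction f · d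

-- The inputs are provable from `Θ` rather than members of it, so left rules transform proofs
-- directly.
sound : ∀ {Λ} → C⊢ Λ ▸ Π → Θ ⊢ʰ* Λ → Θ ⊢ʰ ⟪ Π ⟫ₒ

sound-⋀ : C⊢ map _• Δ ▸ Π → [ ⋀ Δ ] ⊢ʰ ⟪ Π ⟫ₒ
sound-⋀ {Δ = Δ} d = sound d (map•⁺ (⋀-elim Δ hyp₀))

sound-⋀⇒ : C⊢ φ • ∷ map _• Δ ▸ Π → [ ⋀ Δ ] ⊢ʰ φ ⇒ ⟪ Π ⟫ₒ
sound-⋀⇒ {Δ = Δ} d = deduction (sound d (hyp₀ ∷ map•⁺ (⋀-elim Δ hyp₁)))

sound (exch (p ▸ q) d) ds = ⊢ʰ-≈ₒ q (sound d (⊢ʰ*-↭ p ds))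
sound ⊥• (d ∷ _) = ax (⊥-elim _) · d
sound id (d ∷ _) = d
sound (∧• d) (e ∷ ds) = sound d (ax (∧-elim₁ _ _) · e ∷ ax (∧-elim₂ _ _) · e ∷ ds)
sound (∧° d e) ds = ax (∧-intro _ _) · sound d ds · sound e ds
sound (∨• d e) (c ∷ ds) =
  cases c (sound d (hyp₀ ∷ All.map weakenʰ ds)) (sound e (hyp₀ ∷ All.map weakenʰ ds))
sound (∨°₁ d) ds = ax (∨-intro₁ _ _) · sound d ds
sound (∨°₂ d) ds = ax (∨-intro₂ _ _) · sound d ds
sound (⇒• {_ ▸ ∅} d e) (c ∷ ds) = sound e (c · sound d (c ∷ ds) ∷ ds)
sound (⇒• {_ ▸ _ °} d e) (c ∷ ds) = sound e (c · sound d (c ∷ ds) ∷ ds)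
-- The empty block left by pruning is read as `□ ⊤`, which follows from `□ (⋀ Δ)`, the antecedent in
-- the reading of the output block.
sound (⇒• {_ ▸ ⟦ Δ , _ °⟧} d e) (c ∷ ds) =
  deduction (sound e (weakenʰ c · sound d (weakenʰ c ∷ □⊤ ∷ ds′) ∷ ds′) · hyp₀)
  where
  ds′ = All.map weakenʰ ds
  □⊤  = □-monoʰ ⊢ʰ-refl hyp₀
sound (⇒° d) ds = deduction (sound d (hyp₀ ∷ All.map weakenʰ ds))
sound (□• d) (e ∷ ds) = sound d (□-monoʰ (⋀-intro (hyp₀ ∷ [])) e ∷ ds)
sound (□° d) (e ∷ _) = □-monoʰ (sound-⋀ d) e
-- The premiss makes `φ` contradictory under `⋀ Δ`, so K turns `◇ φ` into `◇ ⊥`, which the block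
-- refutes.
sound (◇•ᵢ d) (e ∷ b ∷ ds) = ax (⊥-elim _) · □◇⊥ʰ b (K◇ (□-monoʰ (sound-⋀⇒ d) b) e)
sound (◇•ₒ d) (e ∷ ds) = deduction (K◇ (□-monoʰ (sound-⋀⇒ d) hyp₀) (weakenʰ e))
sound (◇° d) ds = thm (ax-□⊤◇ _) · sound d ds
sound (kᵢ {Δ = Δ} {Σ} d) (e ∷ f ∷ ds) = sound d (□⋀-++ Δ Σ e f ∷ ds)
sound (kₒ {Δ = Δ} {Σ} d) (e ∷ ds) =
  deduction (weakenʰ (sound d ds) · □⋀-++ Δ Σ (weakenʰ e) hyp₀)

-- A contraction-free calculus with a single input block

-- `nothing` is the absence of a block; `just []` is the empty block, read as `□ ⊤`, and enables
-- `□R` and `refute`.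
Block : Set
Block = Maybe (List Formula)

contents : Block → List Formula
contents = fromMaybe []

infix 4 _∣_

record World : Set where
  constructor _∣_
  field
    formulas : List Formula
    block    : Block

open World

private
  variable
    w w′ w″ v : World
    B B′ : Block

-- The empty block left by pruning is merged at once with the input block, so pruning can only turn
-- `nothing` into `just []`.
pruneBlock : Output → Block → Block
pruneBlock ∅           B = B
pruneBlock (_ °)       B = B
pruneBlock ⟦ _ , _ °⟧ B = just (contents B)

addToBlock : Formula → Block → Block
addToBlock φ B = just (φ ∷ contents B)

inside : World → World
inside w = contents (block w) ∣ nothing

-- ◇Step B π Π: with input block B, the rule ◇• reduces the output Π to the
-- output π of the premiss.
data ◇Step : Block → Output → Output → Set where
  refute  : ◇Step (just Δ) ∅ Π
  witness : ◇Step B (φ °) ⟦ [] , φ °⟧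

infix 3 _⊢_

data _⊢_ : World → Output → Set where
  ⊥L  : ⊥ ∈ Φ → Φ ∣ B ⊢ Π
  id  : ∀ {p} → var p ∈ Φ → Φ ∣ B ⊢ var p °
  ∧L  : Φ ↭ φ ∧ ψ ∷ Φ₀ → φ ∷ ψ ∷ Φ₀ ∣ B ⊢ Π → Φ ∣ B ⊢ Π
  ∧R  : w ⊢ φ ° → w ⊢ ψ ° → w ⊢ (φ ∧ ψ) °
  ∨L  : Φ ↭ φ ∨ ψ ∷ Φ₀ → φ ∷ Φ₀ ∣ B ⊢ Π → ψ ∷ Φ₀ ∣ B ⊢ Π → Φ ∣ B ⊢ Π
  ∨R₁ : w ⊢ φ ° → w ⊢ (φ ∨ ψ) °
  ∨R₂ : w ⊢ ψ ° → w ⊢ (φ ∨ ψ) °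
  ⇒L  : Φ ↭ φ ⇒ ψ ∷ Φ₀ → Φ ∣ pruneBlock Π B ⊢ φ ° → ψ ∷ Φ₀ ∣ B ⊢ Π → Φ ∣ B ⊢ Π
  ⇒R  : φ ∷ Φ ∣ B ⊢ ψ ° → Φ ∣ B ⊢ (φ ⇒ ψ) °
  □L  : Φ ↭ □ φ ∷ Φ₀ → Φ₀ ∣ addToBlock φ B ⊢ Π → Φ ∣ B ⊢ Π
  □R  : Δ ∣ nothing ⊢ φ ° → Φ ∣ just Δ ⊢ (□ φ) °
  ◇L  : ◇ φ ∈ Φ → ◇Step B π Π → φ ∷ contents B ∣ nothing ⊢ π → Φ ∣ B ⊢ Π
  ◇R  : w ⊢ ⟦ [] , φ °⟧ → w ⊢ (◇ φ) °

-- w ∋ φ also holds when φ has already been decomposed by invertible left rules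
-- (or by →•, through its right premiss). Derivability is monotone in ∋, which
-- yields weakening, inversion and contraction by a single induction.
infix 3 _∋_ _≼_ _⊑_ _∥_

data _∋_ (w : World) : Formula → Set where
  lit : φ ∈ formulas w → w ∋ φ
  ∧∋  : w ∋ φ → w ∋ ψ → w ∋ φ ∧ ψ
  ∨∋₁ : w ∋ φ → w ∋ φ ∨ ψ
  ∨∋₂ : w ∋ ψ → w ∋ φ ∨ ψ
  ⇒∋  : w ∋ ψ → w ∋ φ ⇒ ψ
  □∋  : φ ∈ contents (block w) → w ∋ □ φ

data _≼_ : Block → Block → Set where
  none : nothing ≼ B
  some : Δ ⊆ Δ′ → just Δ ≼ just Δ′

record _⊑_ (w w′ : World) : Set where
  constructor _∥_
  field
    ∋-formulas : ∀ {φ} → φ ∈ formulas w → w′ ∋ φ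
    ≼-block    : block w ≼ block w′

open _⊑_

-- The order on worlds and admissible structural rules

≼-refl : B ≼ B
≼-refl {just _}  = some (λ i → i)
≼-refl {nothing} = none

≼-trans : ∀ {B₁ B₂ B₃} → B₁ ≼ B₂ → B₂ ≼ B₃ → B₁ ≼ B₃
≼-trans none     _        = none
≼-trans (some f) (some g) = some (g ∘ f)

≼-contents : B ≼ B′ → contents B ⊆ contents B′
≼-contents none     ()
≼-contents (some f) = f

≼-addToBlock : B ≼ addToBlock φ B
≼-addToBlock {just _}  = some there
≼-addToBlock {nothing} = none

addToBlock-≼ : B ≼ B′ → φ ∈ contents B′ → addToBlock φ B ≼ B′
addToBlock-≼ {B′ = just _} s i = some λ { (here refl) → i ; (there j) → ≼-contents s j }

≼-just-contents : B ≼ just (contents B)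
≼-just-contents {just _}  = some (λ i → i)
≼-just-contents {nothing} = none

≼-pruneBlock : ∀ Π → B ≼ pruneBlock Π B
≼-pruneBlock ∅           = ≼-refl
≼-pruneBlock (_ °)       = ≼-refl
≼-pruneBlock ⟦ _ , _ °⟧ = ≼-just-contents

pruneBlock-mono : ∀ Π → B ≼ B′ → pruneBlock Π B ≼ pruneBlock Π B′
pruneBlock-mono ∅           s = s
pruneBlock-mono (_ °)       s = s
pruneBlock-mono ⟦ _ , _ °⟧ s = some (≼-contents s)

⊑-refl : w ⊑ w
⊑-refl = lit ∥ ≼-refl

∋-resp-⊑ : w ⊑ w′ → w ∋ φ → w′ ∋ φ
∋-resp-⊑ s (lit i)  = ∋-formulas s i
∋-resp-⊑ s (∧∋ d e) = ∧∋ (∋-resp-⊑ s d) (∋-resp-⊑ s e)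
∋-resp-⊑ s (∨∋₁ d)  = ∨∋₁ (∋-resp-⊑ s d)
∋-resp-⊑ s (∨∋₂ d)  = ∨∋₂ (∋-resp-⊑ s d)
∋-resp-⊑ s (⇒∋ d)   = ⇒∋ (∋-resp-⊑ s d)
∋-resp-⊑ s (□∋ i)   = □∋ (≼-contents (≼-block s) i)

⊑-trans : w ⊑ w′ → w′ ⊑ w″ → w ⊑ w″
⊑-trans s t = ∋-resp-⊑ t ∘ ∋-formulas s ∥ ≼-trans (≼-block s) (≼-block t)

⊑-block : B ≼ B′ → Φ ∣ B ⊑ Φ ∣ B′
⊑-block s = lit ∥ s

⊑-∷ : φ ∷ Φ ∣ B ⊑ w → Φ ∣ B ⊑ w
⊑-∷ s = ∋-formulas s ∘ there ∥ ≼-block s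

⊑-∷ʳ : Φ ∣ B ⊑ φ ∷ Φ ∣ B
⊑-∷ʳ = lit ∘ there ∥ ≼-refl

∷-⊑ : w ∋ φ → Φ ∣ B ⊑ w → φ ∷ Φ ∣ B ⊑ w
∷-⊑ d s = (λ { (here refl) → d ; (there i) → ∋-formulas s i }) ∥ ≼-block s

⊑-↭ : Φ ↭ Φ′ → Φ ∣ B ⊑ Φ′ ∣ B
⊑-↭ p = lit ∘ ∈-resp-↭ p ∥ ≼-refl

⊑-tail : Φ ↭ φ ∷ Φ₀ → Φ ∣ B ⊑ w → Φ₀ ∣ B ⊑ w
⊑-tail p s = ⊑-∷ (⊑-trans (⊑-↭ (↭-sym p)) s)

⊑-replace : Φ ↭ φ ∷ Φ₀ → w ∋ φ → Φ₀ ∣ B ⊑ w → Φ ∣ B ⊑ w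
⊑-replace p d s = ⊑-trans (⊑-↭ p) (∷-⊑ d s)

∋-head : Φ ↭ φ ∷ Φ₀ → φ ∈ Φ
∋-head p = ∈-resp-↭ (↭-sym p) (here refl)

inside-⊑ : w ⊑ w′ → inside w ⊑ inside w′
inside-⊑ s = lit ∘ ≼-contents (≼-block s) ∥ none

prune-⊑ : ∀ Π → w ⊑ w′ →
          formulas w ∣ pruneBlock Π (block w) ⊑ formulas w′ ∣ pruneBlock Π (block w′)
prune-⊑ Π s = ∋-resp-⊑ (⊑-block (≼-pruneBlock Π)) ∘ ∋-formulas s ∥ pruneBlock-mono Π (≼-block s)

◇Step-≼ : B ≼ B′ → ◇Step B π Π → ◇Step B′ π Π
◇Step-≼ (some _) refute  = refute
◇Step-≼ s        witness = witness

∈⇒↭ : φ ∈ Φ → ∃ λ Φ₀ → Φ ↭ φ ∷ Φ₀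
∈⇒↭ i with ys , zs , refl ← ∈-∃++ i = ys ++ zs , shift _ ys zs

-- If the formula is already decomposed, the continuation applies in place. Otherwise the left rule
-- is used, and its premiss is a larger world because `∋` still counts the principal formula there.
-- The next three lemmas follow the same pattern.
∧L⁺ : w ∋ φ ∧ ψ → (∀ {w′} → w ⊑ w′ → w′ ∋ φ → w′ ∋ ψ → w′ ⊢ Π) → w ⊢ Π
∧L⁺ (∧∋ d e) k = k ⊑-refl d e
∧L⁺ (lit i)  k with _ , p ← ∈⇒↭ i =
  ∧L p (k (⊑-replace p (∧∋ φ∋ ψ∋) (⊑-trans ⊑-∷ʳ ⊑-∷ʳ)) φ∋ ψ∋)
  where
  φ∋ = lit (here refl)
  ψ∋ = lit (there (here refl))

∨L⁺ : w ∋ φ ∨ ψ → (∀ {w′} → w ⊑ w′ → w′ ∋ φ → w′ ⊢ Π) →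
      (∀ {w′} → w ⊑ w′ → w′ ∋ ψ → w′ ⊢ Π) → w ⊢ Π
∨L⁺ (∨∋₁ d) k l = k ⊑-refl d
∨L⁺ (∨∋₂ d) k l = l ⊑-refl d
∨L⁺ (lit i) k l with _ , p ← ∈⇒↭ i =
  ∨L p (k (⊑-replace p (∨∋₁ hd) ⊑-∷ʳ) hd) (l (⊑-replace p (∨∋₂ hd) ⊑-∷ʳ) hd)
  where
  hd : ∀ {φ Φ B} → φ ∷ Φ ∣ B ∋ φ
  hd = lit (here refl)

⇒L⁺ : w ∋ φ ⇒ ψ → formulas w ∣ pruneBlock Π (block w) ⊢ φ ° →
      (∀ {w′} → w ⊑ w′ → w′ ∋ ψ → w′ ⊢ Π) → w ⊢ Π
⇒L⁺ (⇒∋ d)  e k = k ⊑-refl d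
⇒L⁺ (lit i) e k with _ , p ← ∈⇒↭ i =
  ⇒L p e (k (⊑-replace p (⇒∋ (lit (here refl))) ⊑-∷ʳ) (lit (here refl)))

□L⁺ : w ∋ □ φ → (∀ {w′} → w ⊑ w′ → φ ∈ contents (block w′) → w′ ⊢ Π) → w ⊢ Π
□L⁺ (□∋ i)  k = k ⊑-refl i
□L⁺ (lit i) k with _ , p ← ∈⇒↭ i =
  □L p (k (⊑-replace p (□∋ (here refl)) (⊑-block ≼-addToBlock)) (here refl))

⊢-mono : w ⊑ w′ → w ⊢ Π → w′ ⊢ Π
-- Containment of `⊥`, variables and ◇-formulas can only come from `lit`, so they still occur
-- literally in the larger world.
⊢-mono s (⊥L i) with lit j ← ∋-formulas s i = ⊥L j
⊢-mono s (id i) with lit j ← ∋-formulas s i = id j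
⊢-mono s (∧L p d) =
  ∧L⁺ (∋-formulas s (∋-head p)) λ t a b → ⊢-mono (∷-⊑ a (∷-⊑ b (⊑-tail p (⊑-trans s t)))) d
⊢-mono s (∧R d e) = ∧R (⊢-mono s d) (⊢-mono s e)
⊢-mono s (∨L p d e) =
  ∨L⁺ (∋-formulas s (∋-head p))
    (λ t a → ⊢-mono (∷-⊑ a (⊑-tail p (⊑-trans s t))) d)
    (λ t b → ⊢-mono (∷-⊑ b (⊑-tail p (⊑-trans s t))) e)
⊢-mono s (∨R₁ d) = ∨R₁ (⊢-mono s d)
⊢-mono s (∨R₂ d) = ∨R₂ (⊢-mono s d)
⊢-mono {Π = Π} s (⇒L p d e) =
  ⇒L⁺ (∋-formulas s (∋-head p)) (⊢-mono (prune-⊑ Π s) d)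
    (λ t b → ⊢-mono (∷-⊑ b (⊑-tail p (⊑-trans s t))) e)
⊢-mono s (⇒R d) = ⇒R (⊢-mono (∷-⊑ (lit (here refl)) (⊑-trans s ⊑-∷ʳ)) d)
⊢-mono s (□L p d) =
  □L⁺ (∋-formulas s (∋-head p)) λ t i →
    ⊢-mono (∋-formulas (⊑-tail p (⊑-trans s t)) ∥ addToBlock-≼ (≼-block (⊑-trans s t)) i) d
⊢-mono (_ ∥ some f) (□R d) = □R (⊢-mono (lit ∘ f ∥ none) d)
⊢-mono s (◇L i g d) with lit j ← ∋-formulas s i =
  ◇L j (◇Step-≼ (≼-block s) g)
    (⊢-mono (∷-⊑ (lit (here refl)) (⊑-trans (inside-⊑ s) ⊑-∷ʳ)) d)
⊢-mono s (◇R d) = ◇R (⊢-mono s d)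

-- No right rule has output `∅`, and `refute` already allows any output in its conclusion.
exfalso : w ⊢ ∅ → w ⊢ Π
exfalso (⊥L i)      = ⊥L i
exfalso (∧L p d)    = ∧L p (exfalso d)
exfalso (∨L p d e)  = ∨L p (exfalso d) (exfalso e)
exfalso {Π = Π} (⇒L p d e) = ⇒L p (⊢-mono (⊑-block (≼-pruneBlock Π)) d) (exfalso e)
exfalso (□L p d)    = □L p (exfalso d)
exfalso (◇L i refute d) = ◇L i refute d

-- The syntactic core of (□⊤ → ◇φ) → ◇φ. Pruning and `□L` give the same block from `nothing` as from
-- `just []`, and a `refute` step becomes a `witness` step.
drop-empty-block : Φ ∣ just [] ⊢ ⟦ [] , φ °⟧ → Φ ∣ nothing ⊢ ⟦ [] , φ °⟧
drop-empty-block (⊥L i)           = ⊥L i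
drop-empty-block (∧L p d)         = ∧L p (drop-empty-block d)
drop-empty-block (∨L p d e)       = ∨L p (drop-empty-block d) (drop-empty-block e)
drop-empty-block (⇒L p d e)       = ⇒L p d (drop-empty-block e)
drop-empty-block (□L p d)         = □L p d
drop-empty-block (◇L i refute d)  = ◇L i witness (exfalso d)
drop-empty-block (◇L i witness d) = ◇L i witness d

-- Forcing over the worlds of the calculus

-- A covering condition: to derive any output at a later world, it suffices to derive it at the
-- worlds beyond where `P` holds.
Cl : (World → Set) → World → Set
Cl P w = ∀ {w′ Π} → w ⊑ w′ → (∀ {w″} → w′ ⊑ w″ → P w″ → w″ ⊢ Π) → w′ ⊢ Π

infix 3 _⊩_

_⊩_ : World → Formula → Set
w ⊩ var p = w ⊢ var p °
w ⊩ ⊥     = w ⊢ ∅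
w ⊩ φ ∧ ψ = (w ⊩ φ) × (w ⊩ ψ)
w ⊩ φ ∨ ψ = Cl (λ w′ → (w′ ⊩ φ) ⊎ (w′ ⊩ ψ)) w
w ⊩ φ ⇒ ψ = ∀ {w′} → w ⊑ w′ → w′ ⊩ φ → w′ ⊩ ψ
w ⊩ □ φ   = Cl (λ w′ → ∃ λ Δ → block w′ ≡ just Δ × (inside w′ ⊩ φ)) w
w ⊩ ◇ φ   = ∀ {w′ π Π} → w ⊑ w′ → ◇Step (block w′) π Π →
            (∀ {v} → inside w′ ⊑ v → v ⊩ φ → v ⊢ π) → w′ ⊢ Π

Cl-join : ∀ {P : World → Set} → Cl (Cl P) w → Cl P w
Cl-join c s k = c s λ t d → d ⊑-refl λ u → k (⊑-trans t u)

⊩-mono : ∀ φ → w ⊑ w′ → w ⊩ φ → w′ ⊩ φ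
⊩-mono (var p) s d       = ⊢-mono s d
⊩-mono ⊥       s d       = ⊢-mono s d
⊩-mono (φ ∧ ψ) s (a , b) = ⊩-mono φ s a , ⊩-mono ψ s b
⊩-mono (φ ∨ ψ) s c t     = c (⊑-trans s t)
⊩-mono (φ ⇒ ψ) s f t     = f (⊑-trans s t)
⊩-mono (□ φ)   s c t     = c (⊑-trans s t)
⊩-mono (◇ φ)   s c t     = c (⊑-trans s t)

-- This allows a forced disjunction or box to be eliminated into any forced formula.
⊩-closed : ∀ φ → Cl (_⊩ φ) w → w ⊩ φ
⊩-closed (var p) c     = c ⊑-refl λ _ d → d
⊩-closed ⊥       c     = c ⊑-refl λ _ d → d
⊩-closed (φ ∧ ψ) c     = ⊩-closed φ (λ s k → c s λ t a → k t (proj₁ a))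
                       , ⊩-closed ψ (λ s k → c s λ t a → k t (proj₂ a))
⊩-closed (φ ∨ ψ) c     = Cl-join c
⊩-closed (φ ⇒ ψ) c s a =
  ⊩-closed ψ λ t k → c (⊑-trans s t) λ u f → k u (f ⊑-refl (⊩-mono φ (⊑-trans t u) a))
⊩-closed (□ φ)   c     = Cl-join c
⊩-closed (◇ φ)   c s g k =
  c s λ t h → h ⊑-refl (◇Step-≼ (≼-block t) g) λ u → k (⊑-trans (inside-⊑ t) u)

∅-forces : ∀ φ → w ⊢ ∅ → w ⊩ φ
∅-forces φ d = ⊩-closed φ λ s _ → exfalso (⊢-mono s d)

reflect : ∀ φ → w ∋ φ → w ⊩ φ
reify   : ∀ φ → w ⊩ φ → w ⊢ φ °

reflect (var p) (lit i) = id i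
reflect ⊥       (lit i) = ⊥L i
reflect (φ ∧ ψ) d =
    ⊩-closed φ (λ s k → ∧L⁺ (∋-resp-⊑ s d) λ t a _ → k t (reflect φ a))
  , ⊩-closed ψ (λ s k → ∧L⁺ (∋-resp-⊑ s d) λ t _ b → k t (reflect ψ b))
reflect (φ ∨ ψ) d s k =
  ∨L⁺ (∋-resp-⊑ s d) (λ t a → k t (inj₁ (reflect φ a))) (λ t b → k t (inj₂ (reflect ψ b)))
reflect (φ ⇒ ψ) d s a =
  ⊩-closed ψ λ {_} {Π} t k →
    -- Reifying the forced antecedent gives the left premiss, which is then moved up to the pruned
    -- world.
    ⇒L⁺ (∋-resp-⊑ (⊑-trans s t) d)
      (⊢-mono (⊑-trans t (⊑-block (≼-pruneBlock Π))) (reify φ a))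
      (λ u b → k u (reflect ψ b))
reflect (□ φ) d s k =
  □L⁺ (∋-resp-⊑ s d) λ { {_ ∣ just Δ} t i → k t (Δ , refl , reflect φ (lit i)) }
reflect (◇ φ) d s g k with lit i ← ∋-resp-⊑ s d =
  ◇L i g (k ⊑-∷ʳ (reflect φ (lit (here refl))))

reify (var p) d       = d
reify ⊥       d       = exfalso d
reify (φ ∧ ψ) (a , b) = ∧R (reify φ a) (reify ψ b)
reify (φ ∨ ψ) c       =
  c ⊑-refl λ { _ (inj₁ a) → ∨R₁ (reify φ a) ; _ (inj₂ b) → ∨R₂ (reify ψ b) }
reify (φ ⇒ ψ) f       = ⇒R (reify ψ (f ⊑-∷ʳ (reflect φ (lit (here refl)))))
reify (□ φ)   c       = c ⊑-refl λ { {_ ∣ just Δ} _ (_ , _ , a) → □R (reify φ a) }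
-- With `witness`, the forcing clause produces exactly the premiss of `◇R`.
reify (◇ φ)   c       = ◇R (c ⊑-refl witness λ _ a → reify φ a)

-- Completeness

⊩-IPCAxiom : IPCAxiom φ → ∀ σ → w ⊩ φ ⟨ σ ⟩
⊩-IPCAxiom (⇒-const φ _)  σ _ a t _ = ⊩-mono (φ ⟨ σ ⟩) t a
⊩-IPCAxiom (⇒-dist φ _ _) σ _ f t g u a = f (⊑-trans t u) a ⊑-refl (g u a)
⊩-IPCAxiom (∧-intro φ _)  σ _ a t b = ⊩-mono (φ ⟨ σ ⟩) t a , b
⊩-IPCAxiom (∧-elim₁ _ _)  σ _ = proj₁
⊩-IPCAxiom (∧-elim₂ _ _)  σ _ = proj₂
⊩-IPCAxiom (∨-intro₁ φ _) σ _ a s k = k ⊑-refl (inj₁ (⊩-mono (φ ⟨ σ ⟩) s a))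
⊩-IPCAxiom (∨-intro₂ _ ψ) σ _ b s k = k ⊑-refl (inj₂ (⊩-mono (ψ ⟨ σ ⟩) s b))
⊩-IPCAxiom (∨-elim _ _ χ) σ _ f t g u c = ⊩-closed (χ ⟨ σ ⟩) λ s k → c s λ where
  v (inj₁ a) → k v (f (⊑-trans t (⊑-trans u (⊑-trans s v))) a)
  v (inj₂ b) → k v (g (⊑-trans u (⊑-trans s v)) b)
⊩-IPCAxiom (⊥-elim φ)     σ _ d = ∅-forces (φ ⟨ σ ⟩) d

⟨⟩-∘ : ∀ φ σ τ → φ ⟨ σ ⟩ ⟨ τ ⟩ ≡ φ ⟨ (λ p → σ p ⟨ τ ⟩) ⟩
⟨⟩-∘ (var p) σ τ = refl
⟨⟩-∘ ⊥       σ τ = refl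
⟨⟩-∘ (φ ∧ ψ) σ τ = cong₂ _∧_ (⟨⟩-∘ φ σ τ) (⟨⟩-∘ ψ σ τ)
⟨⟩-∘ (φ ∨ ψ) σ τ = cong₂ _∨_ (⟨⟩-∘ φ σ τ) (⟨⟩-∘ ψ σ τ)
⟨⟩-∘ (φ ⇒ ψ) σ τ = cong₂ _⇒_ (⟨⟩-∘ φ σ τ) (⟨⟩-∘ ψ σ τ)
⟨⟩-∘ (□ φ)   σ τ = cong □_ (⟨⟩-∘ φ σ τ)
⟨⟩-∘ (◇ φ)   σ τ = cong ◇_ (⟨⟩-∘ φ σ τ)

⟨var⟩ : ∀ φ → φ ⟨ var ⟩ ≡ φ
⟨var⟩ (var p) = refl
⟨var⟩ ⊥       = refl
⟨var⟩ (φ ∧ ψ) = cong₂ _∧_ (⟨var⟩ φ) (⟨var⟩ ψ)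
⟨var⟩ (φ ∨ ψ) = cong₂ _∨_ (⟨var⟩ φ) (⟨var⟩ ψ)
⟨var⟩ (φ ⇒ ψ) = cong₂ _⇒_ (⟨var⟩ φ) (⟨var⟩ ψ)
⟨var⟩ (□ φ)   = cong □_ (⟨var⟩ φ)
⟨var⟩ (◇ φ)   = cong ◇_ (⟨var⟩ φ)

-- The implication is required only above `inside w`, so this serves K, where it holds in the block,
-- as well as `□-mono`.
⊩-□-map : ∀ φ ψ → (∀ {v} → inside w ⊑ v → v ⊩ φ → v ⊩ ψ) → w ⊩ □ φ → w ⊩ □ ψ
⊩-□-map φ ψ f c s k =
  c s λ { t (Δ , e , a) → k t (Δ , e , f (inside-⊑ (⊑-trans s t)) a) }

⊩-◇-map : ∀ φ ψ → (∀ {v} → inside w ⊑ v → v ⊩ φ → v ⊩ ψ) → w ⊩ ◇ φ → w ⊩ ◇ ψ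
⊩-◇-map φ ψ f c s g k = c s g λ u a → k u (f (⊑-trans (inside-⊑ s) u) a)

-- `□ φ` supplies a block whose contents force `φ`; `refute` then asks only for output `∅` inside
-- it, where `¬ φ` is forced.
⊩-□◇⊥ : ∀ φ → w ⊩ □ φ → w ⊩ ◇ (¬ φ) → w ⊢ ∅
⊩-□◇⊥ φ c d = c ⊑-refl λ { {_ ∣ just Δ} s (_ , _ , a) →
  d s refute λ t f → f ⊑-refl (⊩-mono φ t a) }

⊩-□⊤◇ : ∀ φ → w ⊩ □ ⊤ ⇒ ◇ φ → w ⊩ ◇ φ
⊩-□⊤◇ φ f {_ ∣ just Δ} s g k =
  f s (λ { {_ ∣ just Δ′} t l → l ⊑-refl (Δ′ , refl , λ _ d → d)
         ; {_ ∣ nothing} (_ ∥ ()) _ }) ⊑-refl g k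
-- Without a block only `witness` is possible. The block case is applied after adding an empty
-- block, which leaves `inside` unchanged, and that block is then dropped.
⊩-□⊤◇ φ f {_ ∣ nothing} s witness k =
  drop-empty-block (⊩-□⊤◇ φ f (⊑-trans s (⊑-block none)) witness k)

⊩-K□ : ∀ φ ψ → w ⊩ □ (φ ⇒ ψ) → w ⊩ □ φ → w ⊩ □ ψ
⊩-K□ φ ψ c d =
  ⊩-closed (□ ψ) λ s k → c s λ { t (_ , _ , f) →
    k t (⊩-□-map φ ψ f (⊩-mono (□ φ) (⊑-trans s t) d)) }

⊩-K◇ : ∀ φ ψ → w ⊩ □ (φ ⇒ ψ) → w ⊩ ◇ φ → w ⊩ ◇ ψ
⊩-K◇ φ ψ c d =
  ⊩-closed (◇ ψ) λ s k → c s λ { t (_ , _ , f) →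
    k t (⊩-◇-map φ ψ f (⊩-mono (◇ φ) (⊑-trans s t) d)) }

-- Quantifying over all substitutions reduces the rule `us` to composing them.
⊩-sound : ⊢IM⊕K φ → ∀ σ {w} → w ⊩ φ ⟨ σ ⟩
⊩-sound (ipc a) σ = ⊩-IPCAxiom a σ
⊩-sound (ax-□◇⊥ φ) σ _ (c , d) = ⊩-□◇⊥ (φ ⟨ σ ⟩) c d
⊩-sound (ax-□⊤◇ φ) σ _ = ⊩-□⊤◇ (φ ⟨ σ ⟩)
⊩-sound (ax-K φ ψ) σ =
    (λ _ c s → ⊩-K□ (φ ⟨ σ ⟩) (ψ ⟨ σ ⟩) (⊩-mono (□ (φ ⇒ ψ) ⟨ σ ⟩) s c))
  , (λ _ c s → ⊩-K◇ (φ ⟨ σ ⟩) (ψ ⟨ σ ⟩) (⊩-mono (□ (φ ⇒ ψ) ⟨ σ ⟩) s c))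
⊩-sound (□-mono {φ} {ψ} d) σ _ = ⊩-□-map (φ ⟨ σ ⟩) (ψ ⟨ σ ⟩) λ _ → ⊩-sound d σ ⊑-refl
⊩-sound (◇-mono {φ} {ψ} d) σ _ = ⊩-◇-map (φ ⟨ σ ⟩) (ψ ⟨ σ ⟩) λ _ → ⊩-sound d σ ⊑-refl
⊩-sound (mp d e) σ = ⊩-sound d σ ⊑-refl (⊩-sound e σ)
⊩-sound (us {φ} σ d) τ {w} = subst (w ⊩_) (sym (⟨⟩-∘ φ σ τ)) (⊩-sound d _)

⊢-complete : ⊢IM⊕K φ → w ⊢ φ °
⊢-complete {φ} {w} d = reify φ (subst (w ⊩_) (⟨var⟩ φ) (⊩-sound d var))

-- Translation into the nested calculus

blocks : Block → List Input
blocks (just Δ) = [ ⟦ Δ ⟧ ]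
blocks nothing  = []

⌜_⌝ : World → List Input
⌜ Φ ∣ B ⌝ = map _• Φ ++ blocks B

≈ᵢ-refl : ∀ {x} → x ≈ᵢ x
≈ᵢ-refl {_ •}   = fm
≈ᵢ-refl {⟦ _ ⟧} = blk Perm.refl

≈ₒ-refl : Π ≈ₒ Π
≈ₒ-refl {∅}           = empty
≈ₒ-refl {_ °}         = fm
≈ₒ-refl {⟦ _ , _ °⟧} = blk Perm.refl

↭⇒Permutation : ∀ {Λ Λ′} → Λ ↭ Λ′ → Permutation _≈ᵢ_ Λ Λ′
↭⇒Permutation Perm.refl         = Permutation.refl (Pointwise.refl ≈ᵢ-refl)
↭⇒Permutation (Perm.prep _ p)   = Permutation.prep ≈ᵢ-refl (↭⇒Permutation p)
↭⇒Permutation (Perm.swap _ _ p) = Permutation.swap ≈ᵢ-refl ≈ᵢ-refl (↭⇒Permutation p)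
↭⇒Permutation (Perm.trans p q)  = Permutation.trans (↭⇒Permutation p) (↭⇒Permutation q)

exchange : ∀ {Λ Λ′} → Λ ↭ Λ′ → C⊢ Λ ▸ Π → C⊢ Λ′ ▸ Π
exchange p = exch (↭⇒Permutation p ▸ ≈ₒ-refl)

⌜⌝-↭ : Φ ↭ Φ′ → ⌜ Φ ∣ B ⌝ ↭ ⌜ Φ′ ∣ B ⌝
⌜⌝-↭ {B = B} p = ++⁺ʳ (blocks B) (map⁺ _• p)

block-first : ∀ Φ → ⌜ Φ ∣ just Δ ⌝ ↭ ⟦ Δ ⟧ ∷ map _• Φ
block-first Φ = ++-comm (map _• Φ) _

⌜⌝-nothing : ∀ Δ → ⌜ Δ ∣ nothing ⌝ ≡ map _• Δ
⌜⌝-nothing Δ = ++-identityʳ (map _• Δ)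

new-block : ∀ Φ → ⌜ Φ ∣ just Δ ⌝ ↭ ⟦ Δ ⟧ ∷ ⌜ Φ ∣ nothing ⌝
new-block Φ = ↭-trans (block-first Φ) (Perm.prep _ (↭-reflexive (sym (⌜⌝-nothing Φ))))

C-inside : ∀ Δ → C⊢ ⌜ Δ ∣ nothing ⌝ ▸ Π → C⊢ map _• Δ ▸ Π
C-inside {Π = Π} Δ = subst (λ Λ → C⊢ Λ ▸ Π) (⌜⌝-nothing Δ)

principal : Φ ↭ φ ∷ Φ₀ → C⊢ φ • ∷ ⌜ Φ₀ ∣ B ⌝ ▸ Π → C⊢ ⌜ Φ ∣ B ⌝ ▸ Π
principal {B = B} p = exchange (⌜⌝-↭ {B = B} (↭-sym p))

-- Read upwards, `kₒ` moves the input block, if any, into the empty output block.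
release : ∀ Φ B → C⊢ map _• Φ ▸ ⟦ contents B , θ °⟧ → C⊢ ⌜ Φ ∣ B ⌝ ▸ ⟦ [] , θ °⟧
release Φ (just Δ) d =
  exchange (↭-sym (block-first Φ))
    (kₒ (subst (λ Δ → C⊢ map _• Φ ▸ ⟦ Δ , _ °⟧) (sym (++-identityʳ Δ)) d))
release Φ nothing  d = exchange (↭-reflexive (sym (⌜⌝-nothing Φ))) d

C-prune : ∀ Φ B Π → C⊢ ⌜ Φ ∣ pruneBlock Π B ⌝ ▸ π → C⊢ (⌜ Φ ∣ B ⌝ ▸ Π) ↓ ▸ π
C-prune Φ B ∅ d = d
C-prune Φ B (_ °) d = d
C-prune Φ nothing ⟦ _ , _ °⟧ d = exchange (new-block Φ) d
C-prune Φ (just Δ) ⟦ _ , _ °⟧ d =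
  exchange (Perm.prep _ (↭-sym (block-first Φ))) (kᵢ {Δ = []} (exchange (block-first Φ) d))

↓-↭ : ∀ {Λ Λ′} Π → Λ ↭ Λ′ → (Λ ▸ Π) ↓ ↭ (Λ′ ▸ Π) ↓
↓-↭ ∅           p = p
↓-↭ (_ °)       p = p
↓-↭ ⟦ _ , _ °⟧ p = Perm.prep _ p

↓-∷ : ∀ {Λ x} Π → (x ∷ Λ ▸ Π) ↓ ↭ x ∷ (Λ ▸ Π) ↓
↓-∷ ∅           = Perm.refl
↓-∷ (_ °)       = Perm.refl
↓-∷ ⟦ _ , _ °⟧ = Perm.swap _ _ Perm.refl

⊢⇒C⊢ : w ⊢ Π → C⊢ ⌜ w ⌝ ▸ Π
⊢⇒C⊢ {Φ ∣ B} (⊥L i) with _ , p ← ∈⇒↭ i = principal {B = B} p ⊥•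
⊢⇒C⊢ {Φ ∣ B} (id i) with _ , p ← ∈⇒↭ i = principal {B = B} p id
⊢⇒C⊢ {Φ ∣ B} (∧L p d) = principal {B = B} p (∧• (⊢⇒C⊢ d))
⊢⇒C⊢ (∧R d e) = ∧° (⊢⇒C⊢ d) (⊢⇒C⊢ e)
⊢⇒C⊢ {Φ ∣ B} (∨L p d e) = principal {B = B} p (∨• (⊢⇒C⊢ d) (⊢⇒C⊢ e))
⊢⇒C⊢ (∨R₁ d) = ∨°₁ (⊢⇒C⊢ d)
⊢⇒C⊢ (∨R₂ d) = ∨°₂ (⊢⇒C⊢ d)
⊢⇒C⊢ {Φ ∣ B} {Π} (⇒L p d e) =
  principal {B = B} p
    (⇒• (exchange (↭-trans (↓-↭ Π (⌜⌝-↭ {B = B} p)) (↓-∷ Π)) (C-prune Φ B Π (⊢⇒C⊢ d)))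
        (⊢⇒C⊢ e))
⊢⇒C⊢ (⇒R d) = ⇒° (⊢⇒C⊢ d)
-- `□•` opens a singleton block, which `kᵢ` merges with the existing one.
⊢⇒C⊢ {Φ ∣ just Δ} (□L {Φ₀ = Φ₀} p d) =
  principal {B = just Δ} p (□• (exchange (Perm.prep _ (↭-sym (block-first Φ₀)))
    (kᵢ {Δ = [ _ ]} (exchange (block-first Φ₀) (⊢⇒C⊢ d)))))
⊢⇒C⊢ {Φ ∣ nothing} (□L {Φ₀ = Φ₀} p d) =
  principal {B = nothing} p (□• (exchange (new-block Φ₀) (⊢⇒C⊢ d)))
⊢⇒C⊢ {Φ ∣ just Δ} (□R d) = exchange (↭-sym (block-first Φ)) (□° (C-inside Δ (⊢⇒C⊢ d)))
⊢⇒C⊢ {Φ ∣ just Δ} (◇L {φ = φ} i refute d) with Φ₀ , p ← ∈⇒↭ i =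
  principal {B = just Δ} p
    (exchange (Perm.prep _ (↭-sym (block-first Φ₀)))
      (◇•ᵢ {Γ = map _• Φ₀ ▸ _} (C-inside (φ ∷ Δ) (⊢⇒C⊢ d))))
⊢⇒C⊢ {Φ ∣ B} (◇L {φ = φ} i witness d) with Φ₀ , p ← ∈⇒↭ i =
  principal {B = B} p (release (◇ φ ∷ Φ₀) B (◇•ₒ (C-inside (φ ∷ contents B) (⊢⇒C⊢ d))))
⊢⇒C⊢ (◇R d) = ◇° (⊢⇒C⊢ d)

theorem4p14 : ∀ (φ : Formula) → (⊢IM⊕K φ) ⇔ (C⊢ ([] ▸ φ °))
theorem4p14 φ = mk⇔
  (λ d → ⊢⇒C⊢ (⊢-complete {w = [] ∣ nothing} d))
  (λ d → closed⇒theorem (sound d []))
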